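{- Let $p\ge5$ and consider the white metallic tree $\mathcal W_\pi$ under the penultimate assignment. Then (a) $\pi$ possesses the preferred son property: for every node $\nu$, exactly one son of $\nu$ has metallic code ending with $0$, and the metallic code of that son is the metallic code of $\nu$ followed by $0$; and (b) a node of $\mathcal W_\pi$ is black if and only if its metallic code ends with the digit $0$.
   Context: Fix $p\ge5$. Metallic numbers: $m_{ -1}=0$, $m_0=1$, $m_{n+2}=(p-2)m_{n+1}-m_n$. With $d=p-3$, $c=p-4$, the metallic code of a positive integer $n$ is the unique word $a_k\cdots a_0$ over $\{0,\dots,p-3\}$ with $a_k\ne0$, $n=\sum a_im_i$, containing no factor $d\,c^j\,d$ ($j\ge0$). White metallic tree under an assignment $\alpha$, $\mathcal W_\alpha$: nodes are the positive integers, each black or white; root $1$ is white; nodes are processed in increasing order and node $\nu$ receives $p-2$ sons if white, $p-3$ if black, namely the smallest integers not yet used, in increasing order; the assignment specifies for each node the position of its unique black son among its sons (leftmost = position $1$), the other sons being white. The penultimate assignment $\pi$ puts the black son at the penultimate position. -}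

module Defs where

open import Data.Bool using (if_then_else_)
open import Data.Empty using (⊥)
open import Data.Fin as Fin using (Fin; toℕ; fromℕ)
open import Data.List using (List; []; _∷_; _++_; _∷ʳ_; replicate; length; tabulate)
open import Data.List.NonEmpty as List⁺ using (List⁺; _∷_; _++⁺_)
open import Data.List.Relation.Unary.All using (All)
open import Data.Nat using (ℕ; zero; suc; _+_; _*_; _∸_; _≤_; pred)
open import Data.Product using (∃; ∃!; ∃-syntax; _×_)
open import Function using (_∘_)
open import Relation.Binary.PropositionalEquality using (_≡_; _≢_)
open import Relation.Nullary using (¬_; does)

data Colour : Set where
  black white : Colour

module _ (p : ℕ) where

  -- shiftedMetallic n is m_{n-1}, so that the recurrence can start from
  -- m_{-1} = 0 and m_0 = 1.  For p ≥ 5 the sequence is increasing, hence the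
  -- subtraction is never truncated.
  shiftedMetallic : ℕ → ℕ
  shiftedMetallic zero          = 0
  shiftedMetallic (suc zero)    = 1
  shiftedMetallic (suc (suc n)) =
    (p ∸ 2) * shiftedMetallic (suc n) ∸ shiftedMetallic n

  metallic : ℕ → ℕ
  metallic n = shiftedMetallic (suc n)

  -- Words are written as on paper: the most significant digit is the head.
  Word : Set
  Word = List ℕ

  value : Word → ℕ
  value []      = 0
  value (a ∷ w) = a * metallic (length w) + value w

  NonzeroHead : Word → Set
  NonzeroHead []      = ⊥
  NonzeroHead (a ∷ _) = a ≢ 0

  HasForbiddenFactor : Word → Set
  HasForbiddenFactor w =
    ∃[ j ] ∃[ u ] ∃[ v ] w ≡ u ++ (d ∷ replicate j c ++ d ∷ []) ++ v
    where
    d = p ∸ 3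
    c = p ∸ 4

  Represents : Word → ℕ → Set
  Represents w n =
    All (_≤ p ∸ 3) w × NonzeroHead w × n ≡ value w × ¬ HasForbiddenFactor w

  -- The metallic code of n is *the* representing word of n, so uniqueness is
  -- part of the notion (compare ∃!).
  IsMetallicCode : Word → ℕ → Set
  IsMetallicCode w n =
    Represents w n × (∀ {w′} → Represents w′ n → w ≡ w′)

  CodeEndsWith0 : ℕ → Set
  CodeEndsWith0 n = ∃[ w ] IsMetallicCode (w ∷ʳ 0) n

  -- For p ≥ 5 these are p - 2 and p - 3; the outer suc makes it definitional
  -- that every node has a son, so the queue of the construction never empties.
  sonCount : Colour → ℕ
  sonCount white = suc (p ∸ 3)
  sonCount black = suc (p ∸ 4)

  -- The position of the black son among the sons of a node, were the node to
  -- have the given colour.  Fin counts from 0: the leftmost son has index 0.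
  Assignment : Set
  Assignment = (ν : ℕ) (c : Colour) → Fin (sonCount c)

  penultimate : Assignment
  penultimate ν white = Fin.pred (fromℕ (p ∸ 3))
  penultimate ν black = Fin.pred (fromℕ (p ∸ 4))

  module _ (α : Assignment) where

    sonColour : (ν : ℕ) (c : Colour) → Fin (sonCount c) → Colour
    sonColour ν c i = if does (i Fin.≟ α ν c) then black else white

    sonColours : ℕ → Colour → List⁺ Colour
    sonColours ν white = sonColour ν white Fin.zero ∷ tabulate (sonColour ν white ∘ Fin.suc)
    sonColours ν black = sonColour ν black Fin.zero ∷ tabulate (sonColour ν black ∘ Fin.suc)

    -- Once the nodes 1, …, n have been processed, waiting n lists the colours of
    -- the nodes n + 1, n + 2, … already created (the root being created at the
    -- start).  The smallest unused integer is then n + 1 + length (waiting n).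
    waiting : ℕ → List⁺ Colour
    waiting zero    = white ∷ []
    waiting (suc n) =
      List⁺.tail (waiting n) ++⁺ sonColours (suc n) (List⁺.head (waiting n))

    -- Nodes are the positive integers; the values at 0 are meaningless.
    colour : ℕ → Colour
    colour ν = List⁺.head (waiting (pred ν))

    firstSon : ℕ → ℕ
    firstSon ν = ν + List⁺.length (waiting (pred ν))

    IsSonOf : ℕ → ℕ → Set
    IsSonOf μ ν = ∃ λ (i : Fin (sonCount (colour ν))) → μ ≡ firstSon ν + toℕ i

    PreferredSonProperty : Set
    PreferredSonProperty = ∀ ν → 1 ≤ ν →
      ∃! _≡_ (λ μ → IsSonOf μ ν × CodeEndsWith0 μ)
      × (∀ μ → IsSonOf μ ν → CodeEndsWith0 μ →
           ∃[ w ] IsMetallicCode w ν × IsMetallicCode (w ∷ʳ 0) μ)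

{-# OPTIONS --safe #-}
module Submission where

-- Say that a digit is maximal in a code when no larger one can replace it; it is
-- then d, or c if the prefix before it already ends with a maximal digit. Adding 1
-- to a code therefore either increments its last digit or, when that digit is
-- maximal, adds 1 to the prefix and writes 0 behind it. Let σ(n) be the number whose
-- code is that of n followed by 0. From
--   value (w a 0) + value w = (p - 2) value (w a)
-- one gets that σ(n + 1) - σ(n) is p - 3 or p - 2 according to whether the code of
-- n + 1 ends with 0 or not, which is the number of sons of n + 1 if the black nodes
-- are those whose code ends with 0. By induction on n, the sons of n + 1 are then
-- σ(n) + 2, ..., σ(n + 1) + 1, and the penultimate one, σ(n + 1), is the only one
-- whose code ends with 0.

open import Data.Empty using (⊥-elim)
open import Data.Fin as Fin using (Fin; toℕ)
open import Data.Fin.Properties using (toℕ-injective; toℕ-fromℕ; toℕ-inject₁; toℕ<n)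
open import Data.List using (List; []; _∷_; _++_; _∷ʳ_; _ʳ++_; replicate; length; tabulate; reverse)
open import Data.List.NonEmpty as List⁺ using (List⁺; _∷_; _++⁺_)
open import Data.List.Properties
  using (∷-injective; ++-assoc; ++-identityʳ; ++-ʳ++; length-++; unfold-reverse; reverse-++;
         reverse-involutive; tabulate-cong)
open import Data.List.Relation.Binary.Permutation.Propositional using (↭-sym)
open import Data.List.Relation.Binary.Permutation.Propositional.Properties using (All-resp-↭; ↭-reverse)
open import Data.List.Relation.Unary.All using (All; []; _∷_)
open import Data.Nat using (ℕ; zero; suc; _+_; _*_; _∸_; _≤_; _<_; z≤n; s≤s; _≟_)
open import Data.Nat.Properties
open import Data.Nat.Tactic.RingSolver using (solve-∀)
open import Data.Product using (∃; ∃-syntax; _×_; _,_; proj₁; proj₂)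
open import Data.Sum using (_⊎_; inj₁; inj₂)
open import Relation.Binary.Definitions using (tri<; tri≈; tri>)
open import Function using (_∘_; id)
open import Function.Bundles using (_⇔_; mk⇔; module Equivalence)
open import Relation.Binary.PropositionalEquality
open import Relation.Nullary using (¬_; yes; no)
open import Defs

replicate-∷ʳ : ∀ {A : Set} n (x : A) → replicate n x ∷ʳ x ≡ replicate (suc n) x
replicate-∷ʳ zero    x = refl
replicate-∷ʳ (suc n) x = cong (x ∷_) (replicate-∷ʳ n x)

toList-++⁺ : ∀ {A : Set} (xs : List A) ys → List⁺.toList (xs ++⁺ ys) ≡ xs ++ List⁺.toList ys
toList-++⁺ []       ys = refl
toList-++⁺ (x ∷ xs) ys = cong (x ∷_) (toList-++⁺ xs ys)

-- Metallic numbers and values of words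

module _ (q : ℕ) where

  private
    p d c : ℕ
    -- With `p` in this form, `p ∸ 2`, `p ∸ 3` and `p ∸ 4` compute to `3 + q`, `d` and `c`, and `d`
    -- is `suc c`.
    p = 5 + q
    d = 2 + q
    c = 1 + q

  -- Needed to make the truncated subtraction of the recurrence exact.
  metallic-mono : ∀ n → shiftedMetallic p n ≤ shiftedMetallic p (suc n)
  metallic-mono zero    = z≤n
  metallic-mono (suc n) = begin
    y                  ≤⟨ m≤m+n y (c * y) ⟩
    d * y              ≡⟨ m+n∸m≡n y (d * y) ⟨
    (3 + q) * y ∸ y    ≤⟨ ∸-monoʳ-≤ ((3 + q) * y) (metallic-mono n) ⟩
    (3 + q) * y ∸ x    ∎
    where
    open ≤-Reasoning
    x = shiftedMetallic p n
    y = shiftedMetallic p (suc n)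

  metallic-rec : ∀ n → shiftedMetallic p (2 + n) + shiftedMetallic p n ≡ (3 + q) * shiftedMetallic p (suc n)
  metallic-rec n = m∸n+n≡m (≤-trans (metallic-mono n) (m≤m+n _ _))

  value-∷ʳ : ∀ w a → value p (w ∷ʳ a) ≡ value p (w ∷ʳ 0) + a
  value-∷ʳ []      a = trans (+-identityʳ _) (*-identityʳ a)
  value-∷ʳ (b ∷ w) a
    rewrite length-++ w {a ∷ []} | length-++ w {0 ∷ []} | value-∷ʳ w a
    = sym (+-assoc (b * metallic p (length w + 1)) _ a)

  -- The metallic recurrence applied to each digit. For the leading digit of a one-digit word it
  -- reads `m₁ = (p - 2) m₀`, because m₋₁ = 0.
  value-∷ʳ-rec : ∀ w a → value p ((w ∷ʳ a) ∷ʳ 0) + value p w ≡ (3 + q) * value p (w ∷ʳ a)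
  value-∷ʳ-rec []      a = lemma (3 + q) a
    where
    lemma : ∀ k a → a * (k * 1) + 0 + 0 ≡ k * (a * 1 + 0)
    lemma = solve-∀
  value-∷ʳ-rec (b ∷ w) a
    rewrite length-++ (w ∷ʳ a) {0 ∷ []} | length-++ w {a ∷ []}
          -- The first rewriting turns `length w + 1 + 1` into `suc (length w + 1)`, which calls for
          -- the second.
          | +-comm (length w) 1 | +-comm (length w) 1
    = begin
      b * m₂ + v₂ + (b * m₀ + v₀)   ≡⟨ regroup b m₂ v₂ m₀ v₀ ⟩
      b * (m₂ + m₀) + (v₂ + v₀)     ≡⟨ cong₂ (λ x y → b * x + y) (metallic-rec (suc (length w))) (value-∷ʳ-rec w a) ⟩
      b * (k * m₁) + k * v₁         ≡⟨ factor b k m₁ v₁ ⟩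
      k * (b * m₁ + v₁)             ∎
    where
    open ≡-Reasoning
    k = 3 + q
    m₀ = metallic p (length w)
    m₁ = metallic p (1 + length w)
    m₂ = metallic p (2 + length w)
    v₀ = value p w
    v₁ = value p (w ∷ʳ a)
    v₂ = value p ((w ∷ʳ a) ∷ʳ 0)
    regroup : ∀ b x y z t → b * x + y + (b * z + t) ≡ b * (x + z) + (y + t)
    regroup = solve-∀
    factor : ∀ b k x y → b * (k * x) + k * y ≡ k * (b * x + y)
    factor = solve-∀

  -- Below, words are reversed: the least significant digit is the head.

  V : List ℕ → ℕ
  V u = value p (reverse u)

  V-∷ : ∀ a u → V (a ∷ u) ≡ V (0 ∷ u) + a
  V-∷ a u rewrite unfold-reverse a u | unfold-reverse 0 u = value-∷ʳ (reverse u) a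

  V-rec : ∀ a u → V (0 ∷ a ∷ u) + V u ≡ (3 + q) * V (a ∷ u)
  V-rec a u rewrite unfold-reverse 0 (a ∷ u) | unfold-reverse a u = value-∷ʳ-rec (reverse u) a

  -- Maximal digits and adding 1

  -- In a code u, the last digit is maximal exactly when u ends, on paper, with d cʲ.
  maxDigit : List ℕ → ℕ
  maxDigit []      = d
  maxDigit (a ∷ u) with a ≟ maxDigit u
  ... | yes _ = c
  ... | no  _ = d

  maxDigit-d⊎c : ∀ u → maxDigit u ≡ d ⊎ maxDigit u ≡ c
  maxDigit-d⊎c []      = inj₁ refl
  maxDigit-d⊎c (a ∷ u) with a ≟ maxDigit u
  ... | yes _ = inj₂ refl
  ... | no  _ = inj₁ refl

  maxDigit≤d : ∀ u → maxDigit u ≤ d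
  maxDigit≤d u with maxDigit-d⊎c u
  ... | inj₁ eq = ≤-reflexive eq
  ... | inj₂ eq = ≤-trans (≤-reflexive eq) (n≤1+n c)

  c≤maxDigit : ∀ u → c ≤ maxDigit u
  c≤maxDigit u with maxDigit-d⊎c u
  ... | inj₁ eq = ≤-trans (n≤1+n c) (≤-reflexive (sym eq))
  ... | inj₂ eq = ≤-reflexive (sym eq)

  maxDigit-maximal : ∀ {a} u → a ≡ maxDigit u → maxDigit (a ∷ u) ≡ c
  maxDigit-maximal {a} u eq with a ≟ maxDigit u
  ... | yes _   = refl
  ... | no  neq = ⊥-elim (neq eq)

  maxDigit-maximal⁻¹ : ∀ {a} u → maxDigit (a ∷ u) ≡ c → a ≡ maxDigit u
  maxDigit-maximal⁻¹ {a} u eq with a ≟ maxDigit u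
  ... | yes a≡ = a≡
  ... | no  _  = ⊥-elim (1+n≢n eq)

  succ : List ℕ → List ℕ
  succ []      = 1 ∷ []
  succ (a ∷ u) with a ≟ maxDigit u
  ... | yes _ = 0 ∷ succ u
  ... | no  _ = suc a ∷ u

  succ-maximal : ∀ u → succ (maxDigit u ∷ u) ≡ 0 ∷ succ u
  succ-maximal u with maxDigit u ≟ maxDigit u
  ... | yes _   = refl
  ... | no  neq = ⊥-elim (neq refl)

  succ-nonmaximal : ∀ {a u} → a < maxDigit u → succ (a ∷ u) ≡ suc a ∷ u
  succ-nonmaximal {a} {u} a<max with a ≟ maxDigit u
  ... | yes eq = ⊥-elim (<⇒≢ a<max eq)
  ... | no  _  = refl

  succ≢[] : ∀ u → succ u ≢ []
  succ≢[] (a ∷ u) eq with a ≟ maxDigit u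
  succ≢[] (a ∷ u) () | yes _
  succ≢[] (a ∷ u) () | no _

  -- Both equations are needed together: a carry uses the second one.
  V-succ : ∀ u → V (succ u) ≡ suc (V u) × V (0 ∷ succ u) ≡ V (0 ∷ u) + suc (maxDigit u)
  V-succ []      = refl , trans (+-identityʳ _) (trans (+-identityʳ _) (*-identityʳ (3 + q)))
  V-succ (a ∷ u) with a ≟ maxDigit u
  -- Here the prefix also grows by 1, so of the `3 + q` given by `V-rec` one unit is lost and
  -- `suc c` remains. Without a carry the prefix is fixed and all of `3 + q`, which is `suc d`,
  -- remains.
  ... | yes refl = V₁ , +-cancelʳ-≡ (suc (V u)) _ _ (begin
      V (0 ∷ 0 ∷ succ u) + suc (V u)    ≡⟨ cong (V (0 ∷ 0 ∷ succ u) +_) (proj₁ (V-succ u)) ⟨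
      V (0 ∷ 0 ∷ succ u) + V (succ u)   ≡⟨ V-rec 0 (succ u) ⟩
      (3 + q) * V (0 ∷ succ u)          ≡⟨ cong ((3 + q) *_) V₁ ⟩
      (3 + q) * suc (V (a ∷ u))         ≡⟨ *-suc (3 + q) (V (a ∷ u)) ⟩
      3 + q + (3 + q) * V (a ∷ u)       ≡⟨ cong (3 + q +_) (V-rec a u) ⟨
      3 + q + (V (0 ∷ a ∷ u) + V u)     ≡⟨ regroup c (V (0 ∷ a ∷ u)) (V u) ⟩
      V (0 ∷ a ∷ u) + suc c + suc (V u) ∎)
    where
    open ≡-Reasoning
    V₁ : V (0 ∷ succ u) ≡ suc (V (a ∷ u))
    V₁ = trans (proj₂ (V-succ u)) (trans (+-suc _ a) (cong suc (sym (V-∷ a u))))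
    regroup : ∀ c x y → suc (suc c) + (x + y) ≡ x + suc c + suc y
    regroup = solve-∀
  ... | no _ = V₁ , +-cancelʳ-≡ (V u) _ _ (begin
      V (0 ∷ suc a ∷ u) + V u           ≡⟨ V-rec (suc a) u ⟩
      (3 + q) * V (suc a ∷ u)           ≡⟨ cong ((3 + q) *_) V₁ ⟩
      (3 + q) * suc (V (a ∷ u))         ≡⟨ *-suc (3 + q) (V (a ∷ u)) ⟩
      3 + q + (3 + q) * V (a ∷ u)       ≡⟨ cong (3 + q +_) (V-rec a u) ⟨
      3 + q + (V (0 ∷ a ∷ u) + V u)     ≡⟨ regroup d (V (0 ∷ a ∷ u)) (V u) ⟩
      V (0 ∷ a ∷ u) + suc d + V u       ∎)
    where
    open ≡-Reasoning
    V₁ : V (suc a ∷ u) ≡ suc (V (a ∷ u))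
    V₁ = trans (V-∷ (suc a) u) (trans (+-suc _ a) (cong suc (sym (V-∷ a u))))
    regroup : ∀ d x y → suc d + (x + y) ≡ x + suc d + y
    regroup = solve-∀

  -- Codes and their uniqueness

  data Code : List ℕ → Set where
    []    : Code []
    -- The bound replaces both the range of the digits and the forbidden factors; the second
    -- condition excludes a leading 0. The empty word is kept as the code of 0.
    digit : ∀ {a u} → a ≤ maxDigit u → (u ≡ [] → a ≢ 0) → Code u → Code (a ∷ u)

  code-tail : ∀ {a u} → Code (a ∷ u) → Code u
  code-tail (digit _ _ C) = C

  code-≤ : ∀ {a u} → Code (a ∷ u) → a ≤ maxDigit u
  code-≤ (digit a≤ _ _) = a≤

  succ-code : ∀ {u} → Code u → Code (succ u)
  succ-code [] = digit (s≤s z≤n) (λ _ ()) []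
  succ-code {a ∷ u} (digit a≤ _ C) with a ≟ maxDigit u
  ... | yes _   = digit z≤n (λ eq → ⊥-elim (succ≢[] u eq)) (succ-code C)
  ... | no  neq = digit (≤∧≢⇒< a≤ neq) (λ _ ()) C

  pred-code : ∀ {a u} → Code (a ∷ u) → ∃[ t ] Code t × succ t ≡ a ∷ u
  pred-code {zero} {[]} (digit _ 0≢ _) = ⊥-elim (0≢ refl refl)
  pred-code {zero} {b ∷ u} (digit _ _ C) with pred-code C
  -- A final 0 comes from a carry, so the predecessor ends with the maximal digit. That digit is
  -- nonzero because `c ≤ maxDigit t` unfolds to `q < maxDigit t`.
  ... | t , Ct , eq = maxDigit t ∷ t
                    , digit ≤-refl (λ _ → m<n⇒n≢0 (c≤maxDigit t)) Ct
                    , trans (succ-maximal t) (cong (0 ∷_) eq)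
  -- Lowering the digit would leave a leading 0, hence the empty word.
  pred-code {suc zero} {[]} _ = [] , [] , refl
  pred-code {suc (suc a)} {[]} (digit a< _ _) =
    suc a ∷ [] , digit (<⇒≤ a<) (λ _ ()) [] , succ-nonmaximal a<
  pred-code {suc a} {b ∷ u} (digit a< _ C) =
    a ∷ b ∷ u , digit (<⇒≤ a<) (λ ()) C , succ-nonmaximal a<

  code : ℕ → List ℕ
  code zero    = []
  code (suc n) = succ (code n)

  code-code : ∀ n → Code (code n)
  code-code zero    = []
  code-code (suc n) = succ-code (code-code n)

  V-code : ∀ n → V (code n) ≡ n
  V-code zero    = refl
  V-code (suc n) = trans (proj₁ (V-succ (code n))) (cong suc (V-code n))

  -- A nonempty code is a successor and `succ` raises the value by 1, so stepping down from `u`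
  -- reaches the empty word after exactly `V u` steps.
  code-unique : ∀ n {u} → Code u → V u ≡ n → u ≡ code n
  code-unique zero    {[]}    C eq = refl
  code-unique (suc n) {[]}    C ()
  code-unique n       {a ∷ u} C eq with pred-code C
  code-unique zero    {a ∷ u} C eq | t , Ct , st≡ =
    ⊥-elim (1+n≢0 (trans (sym (proj₁ (V-succ t))) (trans (cong V st≡) eq)))
  code-unique (suc n) {a ∷ u} C eq | t , Ct , st≡ =
    trans (sym st≡) (cong succ (code-unique n Ct
      (suc-injective (trans (sym (proj₁ (V-succ t))) (trans (cong V st≡) eq)))))

  -- Codes and forbidden factors

  code-ʳ++ : ∀ v {s} → Code (v ʳ++ s) → Code s
  code-ʳ++ []      C = C
  code-ʳ++ (x ∷ v) C = code-tail (code-ʳ++ v C)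

  -- Once the bound is `c`, each further `c` is maximal and keeps it at `c`, so the closing `d`
  -- exceeds it. With `ʳ++` the digits pass onto `s` in reading order.
  ¬code-cʲd : ∀ j {v s} → maxDigit s ≡ c → ¬ Code (((replicate j c ++ d ∷ []) ++ v) ʳ++ s)
  ¬code-cʲd zero {v} {s} max≡c C =
    1+n≰n (subst (d ≤_) max≡c (code-≤ (code-ʳ++ v C)))
  ¬code-cʲd (suc j) {v} {s} max≡c = ¬code-cʲd j {v} (maxDigit-maximal s (sym max≡c))

  code⇒¬forbidden : ∀ w → Code (reverse w) → ¬ HasForbiddenFactor p w
  code⇒¬forbidden _ C (j , u , v , refl) = ¬code-cʲd j {v} max≡c Cw
    where
    s = reverse u
    Cw : Code (((replicate j c ++ d ∷ []) ++ v) ʳ++ (d ∷ s))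
    Cw = subst Code (++-ʳ++ u) C
    -- The opening `d` respects a bound that is itself at most `d`, so it is maximal.
    max≡c : maxDigit (d ∷ s) ≡ c
    max≡c = maxDigit-maximal s
      (≤-antisym (code-≤ (code-ʳ++ ((replicate j c ++ d ∷ []) ++ v) Cw)) (maxDigit≤d s))

  -- A bound `c` means that the preceding digit is maximal: either it is `d` and the search ends, or
  -- it is `c` and the bound before it is again `c`.
  maxDigit-c : ∀ r → maxDigit r ≡ c → ∃[ j ] ∃[ u ] reverse r ≡ u ++ d ∷ replicate j c
  maxDigit-c []      eq = ⊥-elim (1+n≢n eq)
  maxDigit-c (a ∷ r) eq with maxDigit-maximal⁻¹ r eq | maxDigit-d⊎c r
  ... | a≡ | inj₁ max≡d = 0 , reverse r ,
    trans (unfold-reverse a r) (cong (reverse r ∷ʳ_) (trans a≡ max≡d))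
  ... | a≡ | inj₂ max≡c with maxDigit-c r max≡c
  ... | j , u , eq′ = suc j , u , (begin
    reverse (a ∷ r)                 ≡⟨ unfold-reverse a r ⟩
    reverse r ∷ʳ a                  ≡⟨ cong₂ _∷ʳ_ eq′ (trans a≡ max≡c) ⟩
    (u ++ d ∷ replicate j c) ∷ʳ c   ≡⟨ ++-assoc u _ _ ⟩
    u ++ d ∷ (replicate j c ∷ʳ c)   ≡⟨ cong (λ x → u ++ d ∷ x) (replicate-∷ʳ j c) ⟩
    u ++ d ∷ replicate (suc j) c    ∎)
    where open ≡-Reasoning

  forbidden-∷ʳ : ∀ {w} a → HasForbiddenFactor p w → HasForbiddenFactor p (w ∷ʳ a)
  forbidden-∷ʳ a (j , u , v , refl) = j , u , v ∷ʳ a ,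
    trans (++-assoc u _ (a ∷ [])) (cong (u ++_) (++-assoc (d ∷ replicate j c ++ d ∷ []) v (a ∷ [])))

  -- The only way to exceed the bound is a `d` where the bound is `c`, and by `maxDigit-c` this `d`
  -- would close a forbidden factor.
  digit-≤ : ∀ {a} r → a ≤ d → ¬ HasForbiddenFactor p (reverse (a ∷ r)) → a ≤ maxDigit r
  digit-≤ {a} r a≤d ¬f with maxDigit-d⊎c r | a ≟ d
  ... | inj₁ eq | _       = subst (a ≤_) (sym eq) a≤d
  ... | inj₂ eq | no a≢d  = subst (a ≤_) (sym eq) (≤-pred (≤∧≢⇒< a≤d a≢d))
  ... | inj₂ eq | yes refl with maxDigit-c r eq
  ... | j , u , eq′ = ⊥-elim (¬f (j , u , [] , (begin
    reverse (d ∷ r)                            ≡⟨ unfold-reverse d r ⟩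
    reverse r ∷ʳ d                             ≡⟨ cong (_∷ʳ d) eq′ ⟩
    (u ++ d ∷ replicate j c) ∷ʳ d              ≡⟨ ++-assoc u _ _ ⟩
    u ++ (d ∷ replicate j c ++ d ∷ [])         ≡⟨ cong (u ++_) (++-identityʳ _) ⟨
    u ++ (d ∷ replicate j c ++ d ∷ []) ++ []   ∎)))
    where
    open ≡-Reasoning

  nonzeroHead-∷ʳ : ∀ w a b → NonzeroHead p ((w ∷ʳ a) ∷ʳ b) ⇔ NonzeroHead p (w ∷ʳ a)
  nonzeroHead-∷ʳ []      a b = mk⇔ id id
  nonzeroHead-∷ʳ (x ∷ w) a b = mk⇔ id id

  nonzeroHead-reverse : ∀ a b r → NonzeroHead p (reverse (a ∷ b ∷ r)) ⇔ NonzeroHead p (reverse (b ∷ r))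
  nonzeroHead-reverse a b r rewrite unfold-reverse a (b ∷ r) | unfold-reverse b r =
    nonzeroHead-∷ʳ (reverse r) b a

  -- The alternative `r ≡ []` serves the recursion, which ends at the empty word, where
  -- `NonzeroHead` is `⊥`.
  admissible⇒code : ∀ r → All (_≤ d) r → (r ≡ [] ⊎ NonzeroHead p (reverse r)) →
                    ¬ HasForbiddenFactor p (reverse r) → Code r
  admissible⇒code []      _         _        _  = []
  admissible⇒code (a ∷ r) (a≤ ∷ r≤) (inj₂ h) ¬f =
    digit (digit-≤ r a≤ ¬f) (λ { refl → h }) (admissible⇒code r r≤ (head′ r h) ¬f′)
    where
    head′ : ∀ r → NonzeroHead p (reverse (a ∷ r)) → r ≡ [] ⊎ NonzeroHead p (reverse r)
    head′ []      _ = inj₁ refl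
    head′ (b ∷ r) h = inj₂ (Equivalence.to (nonzeroHead-reverse a b r) h)
    ¬f′ : ¬ HasForbiddenFactor p (reverse r)
    ¬f′ f = ¬f (subst (HasForbiddenFactor p) (sym (unfold-reverse a r)) (forbidden-∷ʳ a f))

  represents⇒code : ∀ {w n} → Represents p w n → reverse w ≡ code n
  represents⇒code {w} {n} (w≤ , h , n≡ , ¬f) = code-unique n
    (admissible⇒code (reverse w) (All-resp-↭ (↭-sym (↭-reverse w)) w≤)
      (inj₂ (subst (NonzeroHead p) w≡ h)) (¬f ∘ subst (HasForbiddenFactor p) (sym w≡)))
    (trans (cong (value p) (sym w≡)) (sym n≡))
    where
    w≡ : w ≡ reverse (reverse w)
    w≡ = sym (reverse-involutive w)

  code-digits : ∀ {r} → Code r → All (_≤ d) r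
  code-digits []                    = []
  code-digits (digit {u = u} a≤ _ C) = ≤-trans a≤ (maxDigit≤d u) ∷ code-digits C

  code-nonzeroHead : ∀ {a r} → Code (a ∷ r) → NonzeroHead p (reverse (a ∷ r))
  code-nonzeroHead {a} {[]}    (digit _ a≢0 _) = a≢0 refl
  code-nonzeroHead {a} {b ∷ r} (digit _ _ C)   =
    Equivalence.from (nonzeroHead-reverse a b r) (code-nonzeroHead C)

  -- The hypothesis excludes `n = 0`, whose code is empty and has no nonzero head.
  represents-code : ∀ {n a r} → code n ≡ a ∷ r → Represents p (reverse (code n)) n
  represents-code {n} eq =
    All-resp-↭ (↭-sym (↭-reverse (code n))) (code-digits (code-code n)) ,
    subst (NonzeroHead p ∘ reverse) (sym eq) (code-nonzeroHead (subst Code eq (code-code n))) ,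
    sym (V-code n) ,
    code⇒¬forbidden (reverse (code n)) (subst Code (sym (reverse-involutive (code n))) (code-code n))

  isMetallicCode : ∀ {n a r} → code n ≡ a ∷ r → IsMetallicCode p (reverse (code n)) n
  isMetallicCode {n} eq = represents-code eq , λ {w′} R →
    trans (cong reverse (sym (represents⇒code R))) (reverse-involutive w′)

  endsWith0⇒code : ∀ {w n} → IsMetallicCode p (w ∷ʳ 0) n → code n ≡ 0 ∷ reverse w
  endsWith0⇒code {w} (R , _) = trans (sym (represents⇒code R)) (reverse-++ w (0 ∷ []))

  code⇒endsWith0 : ∀ {u n} → code n ≡ 0 ∷ u → IsMetallicCode p (reverse u ∷ʳ 0) n
  code⇒endsWith0 {u} {n} eq =
    subst (λ w → IsMetallicCode p w n) (trans (cong reverse eq) (unfold-reverse 0 u)) (isMetallicCode eq)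

  -- Colours read off the codes, and the codes of the sons

  lastDigitColour : List ℕ → Colour
  lastDigitColour (zero ∷ _) = black
  lastDigitColour _          = white

  codeColour : ℕ → Colour
  codeColour n = lastDigitColour (code n)

  black⇔endsWith0 : ∀ n → codeColour n ≡ black ⇔ CodeEndsWith0 p n
  black⇔endsWith0 n = mk⇔ (to (code n) refl) (λ (_ , M) → cong lastDigitColour (endsWith0⇒code M))
    where
    to : ∀ r → code n ≡ r → lastDigitColour r ≡ black → CodeEndsWith0 p n
    to (zero ∷ u) eq _ = reverse u , code⇒endsWith0 eq

  σ : ℕ → ℕ
  σ n = V (0 ∷ code n)

  code-σ+ : ∀ n {a} → a ≤ maxDigit (code n) → (code n ≡ [] → a ≢ 0) → code (σ n + a) ≡ a ∷ code n
  code-σ+ n {a} a≤ a≢0 = sym (code-unique (σ n + a) (digit a≤ a≢0 (code-code n)) (V-∷ a (code n)))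

  code-σ : ∀ n → code (σ (suc n)) ≡ 0 ∷ code (suc n)
  code-σ n = trans (cong code (sym (+-identityʳ (σ (suc n)))))
                   (code-σ+ (suc n) z≤n (λ eq → ⊥-elim (succ≢[] (code n) eq)))

  -- A carry happens exactly when the last digit is maximal: then the bound after it is `c` and the
  -- successor ends with 0. Otherwise the bound is `d` and the new last digit is positive.
  sonCount-succ : ∀ u → sonCount p (lastDigitColour (succ u)) ≡ suc (maxDigit u)
  sonCount-succ []      = refl
  sonCount-succ (a ∷ u) with a ≟ maxDigit u
  ... | yes _ = refl
  ... | no  _ = refl

  σ-suc : ∀ n → σ (suc n) ≡ σ n + sonCount p (codeColour (suc n))
  σ-suc n = trans (proj₂ (V-succ (code n))) (cong (σ n +_) (sym (sonCount-succ (code n))))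

  toℕ-penultimate : ∀ ν x → 2 + toℕ (penultimate p ν x) ≡ sonCount p x
  toℕ-penultimate ν white = cong (2 +_) (trans (toℕ-inject₁ _) (toℕ-fromℕ c))
  toℕ-penultimate ν black = cong (2 +_) (trans (toℕ-inject₁ _) (toℕ-fromℕ q))

  -- Indices start at 0, so the penultimate one is the number of sons minus 2; this cancels the 2 in
  -- the first son `2 + σ n`.
  penultimate-σ : ∀ n → 2 + σ n + toℕ (penultimate p (suc n) (codeColour (suc n))) ≡ σ (suc n)
  penultimate-σ n = begin
    2 + σ n + k                             ≡⟨ shift (σ n) k ⟩
    σ n + (2 + k)                           ≡⟨ cong (σ n +_) (toℕ-penultimate (suc n) (codeColour (suc n))) ⟩
    σ n + sonCount p (codeColour (suc n))   ≡⟨ σ-suc n ⟨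
    σ (suc n)                               ∎
    where
    open ≡-Reasoning
    k = toℕ (penultimate p (suc n) (codeColour (suc n)))
    shift : ∀ s k → 2 + s + k ≡ s + (2 + k)
    shift = solve-∀

  -- All sons of n + 1 but the last two have the code of n followed by a digit ≥ 2,
  -- and the last one has the code of n + 1 followed by 1.
  codeColour-son : ∀ n (i : Fin (sonCount p (codeColour (suc n)))) →
    codeColour (2 + σ n + toℕ i) ≡ sonColour p (penultimate p) (suc n) (codeColour (suc n)) i
  codeColour-son n i with i Fin.≟ penultimate p (suc n) (codeColour (suc n))
  ... | yes refl = cong lastDigitColour (trans (cong code (penultimate-σ n)) (code-σ n))
  ... | no i≢ with <-cmp (toℕ i) (toℕ (penultimate p (suc n) (codeColour (suc n))))
  ...   | tri≈ _ eq _ = ⊥-elim (i≢ (toℕ-injective eq))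
  ...   | tri< i<k _ _ = cong lastDigitColour (trans (cong code (shift (σ n) (toℕ i)))
            (code-σ+ n {2 + toℕ i} (≤-pred (begin
              3 + toℕ i               ≤⟨ +-monoʳ-≤ 2 i<k ⟩
              2 + toℕ (penultimate p (suc n) (codeColour (suc n))) ≡⟨ toℕ-penultimate (suc n) (codeColour (suc n)) ⟩
              sonCount p (codeColour (suc n)) ≡⟨ sonCount-succ (code n) ⟩
              suc (maxDigit (code n)) ∎)) (λ _ ())))
    where
    open ≤-Reasoning
    shift : ∀ s i → 2 + s + i ≡ s + (2 + i)
    shift = solve-∀
  ...   | tri> _ _ k<i = cong lastDigitColour (trans (cong code (begin
              2 + σ n + toℕ i       ≡⟨ cong (2 + σ n +_) i≡ ⟩
              2 + σ n + (1 + k)     ≡⟨ shift (2 + σ n) k ⟩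
              2 + σ n + k + 1       ≡⟨ cong (_+ 1) (penultimate-σ n) ⟩
              σ (suc n) + 1         ∎))
            (code-σ+ (suc n) {1} (≤-trans (s≤s z≤n) (c≤maxDigit (code (suc n)))) (λ _ ())))
    where
    open ≡-Reasoning
    k = toℕ (penultimate p (suc n) (codeColour (suc n)))
    i≡ : toℕ i ≡ suc k
    i≡ = ≤-antisym (≤-pred (≤-trans (toℕ<n i)
           (≤-reflexive (sym (toℕ-penultimate (suc n) (codeColour (suc n))))))) k<i
    shift : ∀ s k → s + (1 + k) ≡ s + k + 1
    shift = solve-∀

  sonColour-black : ∀ ν x i → sonColour p (penultimate p) ν x i ≡ black → i ≡ penultimate p ν x
  sonColour-black ν x i eq with i Fin.≟ penultimate p ν x
  ... | yes i≡ = i≡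
  sonColour-black ν x i () | no _

  -- The queue of the construction

  codeColours : ℕ → ℕ → List Colour
  codeColours m zero    = []
  codeColours m (suc ℓ) = codeColour m ∷ codeColours (suc m) ℓ

  codeColours-++ : ∀ m k ℓ → codeColours m (k + ℓ) ≡ codeColours m k ++ codeColours (m + k) ℓ
  codeColours-++ m zero    ℓ = cong (λ x → codeColours x ℓ) (sym (+-identityʳ m))
  codeColours-++ m (suc k) ℓ = cong (codeColour m ∷_)
    (trans (codeColours-++ (suc m) k ℓ) (cong (λ x → codeColours (suc m) k ++ codeColours x ℓ) (sym (+-suc m k))))

  tabulate-codeColour : ∀ m ℓ → tabulate {n = ℓ} (λ i → codeColour (m + toℕ i)) ≡ codeColours m ℓ
  tabulate-codeColour m zero    = refl
  tabulate-codeColour m (suc ℓ) = cong₂ _∷_ (cong codeColour (+-identityʳ m))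
    (trans (tabulate-cong (λ i → cong codeColour (+-suc m (toℕ i)))) (tabulate-codeColour (suc m) ℓ))

  sonColours-tabulate : ∀ ν x → List⁺.toList (sonColours p (penultimate p) ν x)
                              ≡ tabulate (sonColour p (penultimate p) ν x)
  sonColours-tabulate ν white = refl
  sonColours-tabulate ν black = refl

  length-codeColours : ∀ m ℓ → length (codeColours m ℓ) ≡ ℓ
  length-codeColours m zero    = refl
  length-codeColours m (suc ℓ) = cong suc (length-codeColours (suc m) ℓ)

  queue : ℕ → List⁺ Colour
  queue = waiting p (penultimate p)

  -- The invariant of the construction. Its second part says that the nodes created so far are 1 to
  -- `σ n + 1`, so the sons of `suc n` start at `2 + σ n`.
  queue-codeColours : ∀ n → ∃[ ℓ ] List⁺.toList (queue n) ≡ codeColours (suc n) ℓ × n + ℓ ≡ suc (σ n)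
  queue-codeColours zero    = 1 , refl , refl
  queue-codeColours (suc n) with queue n | queue-codeColours n
  ... | x ∷ xs | suc ℓ , eq , n+ℓ with ∷-injective eq
  -- The head `x` becomes `codeColour (suc n)`, so `codeColour-son` applies to the sons appended
  -- now.
  ... | refl , refl = ℓ + sonCount p x , (begin
      List⁺.toList (codeColours (2 + n) ℓ ++⁺ sonColours p (penultimate p) (suc n) x)
        ≡⟨ toList-++⁺ (codeColours (2 + n) ℓ) _ ⟩
      codeColours (2 + n) ℓ ++ List⁺.toList (sonColours p (penultimate p) (suc n) x)
        ≡⟨ cong (codeColours (2 + n) ℓ ++_) (begin
             List⁺.toList (sonColours p (penultimate p) (suc n) x) ≡⟨ sonColours-tabulate (suc n) x ⟩
             tabulate (sonColour p (penultimate p) (suc n) x)      ≡⟨ tabulate-cong (codeColour-son n) ⟨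
             tabulate {n = sonCount p x} (λ i → codeColour (2 + σ n + toℕ i))
                                                                   ≡⟨ tabulate-codeColour (2 + σ n) (sonCount p x) ⟩
             codeColours (2 + σ n) (sonCount p x)                  ≡⟨ cong (λ m → codeColours (suc m) (sonCount p x)) suc-n+ℓ ⟨
             codeColours (2 + n + ℓ) (sonCount p x)                ∎) ⟩
      codeColours (2 + n) ℓ ++ codeColours (2 + n + ℓ) (sonCount p x)
        ≡⟨ codeColours-++ (2 + n) ℓ (sonCount p x) ⟨
      codeColours (2 + n) (ℓ + sonCount p x) ∎) , (begin
      suc n + (ℓ + sonCount p x)   ≡⟨ +-assoc (suc n) ℓ _ ⟨
      suc n + ℓ + sonCount p x     ≡⟨ cong (_+ sonCount p x) suc-n+ℓ ⟩
      suc (σ n + sonCount p x)     ≡⟨ cong suc (σ-suc n) ⟨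
      suc (σ (suc n))              ∎)
    where
    open ≡-Reasoning
    suc-n+ℓ : suc n + ℓ ≡ suc (σ n)
    suc-n+ℓ = trans (sym (+-suc n ℓ)) n+ℓ
  queue-codeColours (suc n) | x ∷ xs | zero , () , _

  colour≡codeColour : ∀ n → colour p (penultimate p) (suc n) ≡ codeColour (suc n)
  colour≡codeColour n with queue n | queue-codeColours n
  ... | x ∷ xs | suc ℓ , eq , _ = proj₁ (∷-injective eq)
  ... | x ∷ xs | zero , () , _

  firstSon≡ : ∀ n → firstSon p (penultimate p) (suc n) ≡ 2 + σ n
  firstSon≡ n with queue n | queue-codeColours n
  ... | x ∷ xs | ℓ , eq , n+ℓ =
    cong suc (trans (cong (n +_) (trans (cong length eq) (length-codeColours (suc n) ℓ))) n+ℓ)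

  -- Sons and the preferred son property

  isSonOf≡ : ∀ n μ → IsSonOf p (penultimate p) μ (suc n)
                    ≡ ∃ λ (i : Fin (sonCount p (codeColour (suc n)))) → μ ≡ 2 + σ n + toℕ i
  -- The colour occurs in the type of the index `i`; an equality of types transports the index and
  -- its equation together.
  isSonOf≡ n μ = cong₂ (λ f x → ∃ λ (i : Fin (sonCount p x)) → μ ≡ f + toℕ i)
                       (firstSon≡ n) (colour≡codeColour n)

  σ-isSon : ∀ n → IsSonOf p (penultimate p) (σ (suc n)) (suc n)
  σ-isSon n = subst id (sym (isSonOf≡ n (σ (suc n))))
    (penultimate p (suc n) (codeColour (suc n)) , sym (penultimate-σ n))

  -- The final 0 gives the son the code colour black, which among the sons only the position chosen
  -- by `penultimate` has.
  son-endsWith0 : ∀ n {μ} → IsSonOf p (penultimate p) μ (suc n) → CodeEndsWith0 p μ → μ ≡ σ (suc n)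
  son-endsWith0 n {μ} son e with subst id (isSonOf≡ n μ) son
  ... | i , refl = trans (cong (λ i → 2 + σ n + toℕ i) i≡) (penultimate-σ n)
    where
    i≡ : i ≡ penultimate p (suc n) (codeColour (suc n))
    i≡ = sonColour-black (suc n) (codeColour (suc n)) i
      (trans (sym (codeColour-son n i)) (Equivalence.from (black⇔endsWith0 _) e))

  preferredSon : PreferredSonProperty p (penultimate p)
  preferredSon (suc n) _ =
    (σ (suc n) , (σ-isSon n , _ , σ-code) , λ (son , e) → sym (son-endsWith0 n son e)) ,
    λ μ son e → w , w-code ,
      subst (IsMetallicCode p (w ∷ʳ 0)) (sym (son-endsWith0 n son e)) σ-code
    where
    w = reverse (code (suc n))
    σ-code : IsMetallicCode p (w ∷ʳ 0) (σ (suc n))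
    σ-code = code⇒endsWith0 (code-σ n)
    w-code : IsMetallicCode p w (suc n)
    w-code with code (suc n) in eq
    ... | []    = ⊥-elim (succ≢[] (code n) eq)
    ... | a ∷ r = subst (λ r → IsMetallicCode p (reverse r) (suc n)) eq (isMetallicCode eq)

theorem5 : (p : ℕ) → 5 ≤ p →
    PreferredSonProperty p (penultimate p)
    × (∀ ν → 1 ≤ ν → colour p (penultimate p) ν ≡ black ⇔ CodeEndsWith0 p ν)
theorem5 (suc (suc (suc (suc (suc q))))) (s≤s (s≤s (s≤s (s≤s (s≤s _))))) =
  preferredSon q , λ { (suc n) _ →
    subst (λ x → x ≡ black ⇔ CodeEndsWith0 (5 + q) (suc n)) (sym (colour≡codeColour q n)) (black⇔endsWith0 q (suc n)) }
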